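{- Let $R$ be a von Neumann regular ring with $\omega(\Gamma'(R))<\infty$. Then $\Gamma'(R)$ is a perfect graph.
   Context: All rings are commutative with identity $1\neq 0$. $W^*(R)$ denotes the set of non-zero non-unit elements of $R$. The cozero-divisor graph $\Gamma'(R)$ is the simple graph with vertex set $W^*(R)$, in which distinct $a,b$ are adjacent iff $a\notin Rb$ and $b\notin Ra$. A ring $R$ is von Neumann regular if for every $r\in R$ there is $s\in R$ with $r=r^2s$. $\omega(G)$ is the clique number of a graph $G$ and $\chi(G)$ its chromatic number. A graph $G$ is perfect if every induced subgraph $H$ of $G$ satisfies $\omega(H)=\chi(H)$. -}

module Defs where

open import Level using (Level; _⊔_; suc)
open import Algebra.Bundles using (CommutativeRing)
open import Algebra.Definitions using (Invertible)
import Algebra.Properties.Semiring.Divisibility as Divisibility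
open import Data.Fin.Base using (Fin)
open import Data.Nat.Base using (ℕ; _≤_)
open import Data.Product.Base using (Σ; ∃; _×_; _,_; proj₁; proj₂)
open import Function.Bundles using (_⟶ₛ_; _⟨$⟩_)
open import Relation.Binary.Bundles using (Setoid)
open import Relation.Binary.Core using (Rel)
open import Relation.Binary.Definitions using (Symmetric; _Respects₂_; _Respects_)
import Relation.Binary.Construct.On as On
open import Relation.Binary.PropositionalEquality.Core using (_≢_)
import Relation.Binary.PropositionalEquality.Properties as ≡
open import Relation.Nullary.Construct.Add.Supremum using (_⁺; ⊤⁺; [_])
open import Relation.Nullary.Negation.Core using (¬_)
open import Relation.Unary using (Pred)

private
  variable
    v e a p : Level

-- Vertices form a setoid, because ring elements do.
record Graph v e a : Set (suc (v ⊔ e ⊔ a)) where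
  field
    vertices : Setoid v e

  open Setoid vertices public
    using (_≈_; _≉_) renaming (Carrier to Vertex)

  field
    Adj      : Rel Vertex a
    Adj-sym  : Symmetric Adj
    Adj⇒≉    : ∀ {x y} → Adj x y → x ≉ y
    Adj-resp : Adj Respects₂ _≈_

-- Distinct indices are sent to distinct vertices by Adj⇒≉, so the image
-- has exactly k vertices.
Clique : Graph v e a → ℕ → Set (v ⊔ a)
Clique G k = Σ (Fin k → Vertex) λ f → ∀ {i j} → i ≢ j → Adj (f i) (f j)
  where open Graph G

Colouring : Graph v e a → ℕ → Set (v ⊔ e ⊔ a)
Colouring G k = Σ (vertices ⟶ₛ ≡.setoid (Fin k)) λ c →
  ∀ {x y} → Adj x y → c ⟨$⟩ x ≢ c ⟨$⟩ y
  where open Graph G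

-- ω and χ take values in ℕ ∪ {∞} = ℕ ⁺, with ∞ = ⊤⁺; they are given as
-- relations, since their values cannot be computed in general.
IsCliqueNumber : Graph v e a → ℕ ⁺ → Set (v ⊔ a)
IsCliqueNumber G [ k ] = Clique G k × (∀ m → Clique G m → m ≤ k)
IsCliqueNumber G ⊤⁺    = ∀ m → Clique G m

IsChromaticNumber : Graph v e a → ℕ ⁺ → Set (v ⊔ e ⊔ a)
IsChromaticNumber G [ k ] = Colouring G k × (∀ m → Colouring G m → k ≤ m)
IsChromaticNumber G ⊤⁺    = ∀ m → ¬ Colouring G m

FiniteCliqueNumber : Graph v e a → Set (v ⊔ a)
FiniteCliqueNumber G = ∃ λ k → IsCliqueNumber G [ k ]

induced : (G : Graph v e a) → Pred (Graph.Vertex G) p → Graph (v ⊔ p) e a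
induced G P = record
  { vertices = On.setoid vertices (proj₁ {B = P})
  ; Adj      = λ x y → Adj (proj₁ x) (proj₁ y)
  ; Adj-sym  = Adj-sym
  ; Adj⇒≉    = Adj⇒≉
  ; Adj-resp = (λ {x} → proj₁ Adj-resp {proj₁ x})
             , (λ {x} → proj₂ Adj-resp {proj₁ x})
  }
  where open Graph G

-- The level p bounds the size of the vertex subsets considered.
Perfect : (p : Level) → Graph v e a → Set (v ⊔ e ⊔ a ⊔ suc p)
Perfect p G = (P : Pred Vertex p) → P Respects _≈_ →
  ∃ λ n → IsCliqueNumber (induced G P) n × IsChromaticNumber (induced G P) n
  where open Graph G

module _ {c ℓ} (R : CommutativeRing c ℓ) where
  open CommutativeRing R
  open Divisibility semiring using (_∤_; ∣-respˡ; ∣-respʳ)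

  Nontrivial : Set ℓ
  Nontrivial = 1# ≉ 0#

  VonNeumannRegular : Set (c ⊔ ℓ)
  VonNeumannRegular = ∀ r → ∃ λ s → r ≈ (r * r) * s

  W* : Pred Carrier (c ⊔ ℓ)
  W* x = x ≉ 0# × ¬ Invertible _≈_ 1# _*_ x

  -- b ∣ a unfolds to ∃ q with q * b ≈ a, that is a ∈ R b.
  CozeroAdj : Rel Carrier (c ⊔ ℓ)
  CozeroAdj x y = x ≉ y × y ∤ x × x ∤ y

  cozeroDivisorGraph : Graph (c ⊔ ℓ) ℓ (c ⊔ ℓ)
  cozeroDivisorGraph = record
    { vertices = On.setoid setoid (proj₁ {B = W*})
    ; Adj      = λ x y → CozeroAdj (proj₁ x) (proj₁ y)
    ; Adj-sym  = λ (x≉y , y∤x , x∤y) → (λ y≈x → x≉y (sym y≈x)) , x∤y , y∤x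
    ; Adj⇒≉    = proj₁
    ; Adj-resp =
        (λ y≈z (x≉y , y∤x , x∤y) →
            (λ x≈z → x≉y (trans x≈z (sym y≈z)))
          , (λ z∣x → y∤x (∣-respˡ (sym y≈z) z∣x))
          , (λ x∣z → x∤y (∣-respʳ (sym y≈z) x∣z)))
      , (λ x≈z (x≉y , y∤x , x∤y) →
            (λ z≈y → x≉y (trans x≈z z≈y))
          , (λ y∣z → y∤x (∣-respʳ (sym x≈z) y∣z))
          , (λ z∣y → x∤y (∣-respˡ (sym x≈z) z∣y)))
    }

{-# OPTIONS --safe #-}

-- In a von Neumann regular ring, pairwise orthogonal non-zero elements are
-- incomparable for divisibility, so finiteness of ω bounds the size of
-- orthogonal families. In a family e₁,…,eₘ that cannot be enlarged the eᵢ
-- behave like the atoms of a finite Boolean algebra: y ∣ x iff every eᵢ not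
-- annihilated by x is not annihilated by y. Hence Γ′(R) is the incomparability
-- graph of the supports {i : x eᵢ ≠ 0}, and so are its induced subgraphs.
-- Perfection is then Dilworth's theorem for a finite family of finite sets,
-- for which we follow Galvin's proof.

module Submission where

open import Defs
open import Level using (Level; _⊔_; lift; lower)
open import Algebra.Bundles using (CommutativeRing)
import Algebra.Properties.CommutativeSemigroup as CommutativeSemigroupProperties
import Algebra.Properties.Group as GroupProperties
import Algebra.Properties.Ring as RingProperties
import Algebra.Properties.Semiring.Divisibility as Divisibility
open import Axiom.ExcludedMiddle using (ExcludedMiddle)
open import Data.Bool.Base using (true; false)
open import Data.Fin.Base using (Fin; zero; suc; toℕ; fromℕ<; punchOut)
open import Data.Fin.Properties
  using (toℕ-fromℕ<; toℕ-injective; fromℕ<-cong; fromℕ<-injective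
        ; any?; punchOut-injective; injective⇒≤)
  renaming (_≟_ to _≟ᶠ_)
open import Data.Fin.Subset using (Subset; inside; outside)
  renaming (_⊆_ to _⊆ˢ_; _⊈_ to _⊈ˢ_; _∈_ to _∈ˢ_)
open import Data.Fin.Subset.Properties
  using (drop-∷-⊆)
  renaming (⊆-refl to ⊆ˢ-refl; ⊆-trans to ⊆ˢ-trans; ⊆-reflexive to ⊆ˢ-reflexive)
open import Data.List.Base using (List; []; _∷_; [_]; _++_; map; filter; length)
open import Data.List.Membership.Propositional using (_∈_; _∉_)
open import Data.List.Membership.Propositional.Properties
  using (∈-filter⁺; ∈-filter⁻; ∈-map⁺; ∈-++⁺ˡ; ∈-++⁺ʳ)
open import Data.List.Properties using (length-filter)
open import Data.List.Relation.Binary.Subset.Propositional using (_⊆_)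
import Data.List.Relation.Unary.All as All
import Data.List.Relation.Unary.All.Properties as All
open import Data.List.Relation.Unary.AllPairs as AllPairs using (AllPairs; []; _∷_)
import Data.List.Relation.Unary.AllPairs.Properties as AllPairs
open import Data.List.Relation.Unary.Any using (here; there)
open import Data.Nat.Base as ℕ using (ℕ; zero; suc; _≤_; _<_; z≤n; s≤s)
import Data.Nat.Properties as ℕ
open import Data.Product.Base using (Σ; ∃; _×_; _,_; proj₁; proj₂)
open import Data.Sum.Base using (_⊎_; inj₁; inj₂; [_,_]′)
import Data.Vec.Base as Vec
import Data.Vec.Functional as Vector
open import Data.Vec.Properties using (lookup∘tabulate; []=⇒lookup; lookup⇒[]=; tabulate-cong)
open import Function.Base using (_∘_; id)
open import Function.Bundles using (_⇔_; mk⇔; _⟨$⟩_; module Equivalence)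
open import Function.Definitions using (Injective)
open import Relation.Binary.Core using (Rel)
open import Relation.Binary.Definitions using (Reflexive; Transitive)
open import Relation.Binary.PropositionalEquality
  using (_≡_; _≢_; refl; sym; trans; cong; subst; subst₂; ≢-sym)
open import Relation.Nullary.Construct.Add.Supremum using () renaming ([_] to finite)
open import Relation.Nullary.Decidable
  using (Dec; yes; no; does; ¬?; map′; decidable-stable; does-⇔; dec-true; dec-false)
open import Relation.Nullary.Negation using (¬_; contradiction)
open import Relation.Unary using (Pred)

private
  variable
    a : Level

-- Excluded middle, bounded search and pigeonhole

lower-em : ∀ b → ExcludedMiddle (a ⊔ b) → ExcludedMiddle a
lower-em b em {P} = map′ lower lift (em {Level.Lift b P})

-- `climb` moves up while `P` holds. Its counter `d` keeps `b < d + m`, so once it reaches zero `m`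
-- has passed the bound.
bounded⇒last : ExcludedMiddle a → (P : ℕ → Set a) → P 0 →
               ∀ b → (∀ m → P m → m ≤ b) → ∃ λ m → P m × ¬ P (suc m)
bounded⇒last em P P0 b P≤b = climb (suc b) 0 P0 (ℕ.m≤m+n (suc b) 0)
  where
  climb : ∀ d m → P m → b < d ℕ.+ m → ∃ λ m → P m × ¬ P (suc m)
  climb zero    m Pm b<m = contradiction (P≤b m Pm) (ℕ.<⇒≱ b<m)
  climb (suc d) m Pm b<  with em {P (suc m)}
  ... | yes Psm = climb d (suc m) Psm (subst (b <_) (sym (ℕ.+-suc d m)) b<)
  ... | no ¬Psm = m , Pm , ¬Psm

-- If `i` were missed, `punchOut` at `i` would turn `f` into an injection into a smaller `Fin`.
injective⇒hits : ∀ {n} {f : Fin n → Fin n} → Injective _≡_ _≡_ f → ∀ i → ∃ λ j → f j ≡ i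
injective⇒hits {suc n} {f} inj i with any? (λ j → f j ≟ᶠ i)
... | yes hit  = hit
... | no  miss = contradiction
  (injective⇒≤ (inj ∘ punchOut-injective (i≢f _) (i≢f _))) ℕ.1+n≰n
  where
  i≢f : ∀ j → i ≢ f j
  i≢f j i≡fj = miss (j , sym i≡fj)

-- Dilworth's theorem

module Dilworth {ℓ : Level} {A : Set ℓ} (em : ExcludedMiddle ℓ) (_≲_ : Rel A ℓ)
         (≲-refl : Reflexive _≲_) (≲-trans : Transitive _≲_) where

  record Antichain (L : List A) (k : ℕ) : Set ℓ where
    field
      member       : Fin k → A
      member∈      : ∀ i → member i ∈ L
      incomparable : ∀ {i j} → i ≢ j → ¬ member i ≲ member j

  -- The chains are the colour classes. They may be empty, so `k` is only an upper bound on how many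
  -- occur.
  record ChainCover (L : List A) (k : ℕ) : Set ℓ where
    field
      colour     : A → ℕ
      colour<    : ∀ {x} → x ∈ L → colour x < k
      comparable : ∀ {x y} → x ∈ L → y ∈ L → colour x ≡ colour y → x ≲ y ⊎ y ≲ x

  open Antichain
  open ChainCover

  -- The order of Galvin's induction: the head lies below no later element, so it is maximal in the
  -- list.
  Descending : List A → Set ℓ
  Descending = AllPairs (λ x y → ¬ x ≲ y)

  antichain-mono : ∀ {L M k} → L ⊆ M → Antichain L k → Antichain M k
  antichain-mono L⊆M 𝒜 = record
    { member = member 𝒜 ; member∈ = L⊆M ∘ member∈ 𝒜 ; incomparable = incomparable 𝒜 }

  cover-mono : ∀ {L k l} → k ≤ l → ChainCover L k → ChainCover L l
  cover-mono k≤l 𝒞 = record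
    { colour = colour 𝒞
    ; colour< = λ x∈L → ℕ.≤-trans (colour< 𝒞 x∈L) k≤l
    ; comparable = comparable 𝒞
    }

  -- Elements outside `M` share the fresh colour `k`, which no element of `M` has.
  cover-adjoin : ∀ {L M k} → ChainCover M k →
                 (∀ {x y} → x ∈ L → y ∈ L → x ∉ M → y ∉ M → x ≲ y ⊎ y ≲ x) →
                 ChainCover L (suc k)
  cover-adjoin {L} {M} {k} 𝒞 chain = record
    { colour = c ; colour< = λ {x} _ → c< x ; comparable = cmp }
    where
    c : A → ℕ
    c x with em {x ∈ M}
    ... | yes _ = colour 𝒞 x
    ... | no  _ = k

    c< : ∀ x → c x < suc k
    c< x with em {x ∈ M}
    ... | yes x∈M = ℕ.m<n⇒m<1+n (colour< 𝒞 x∈M)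
    ... | no  _   = ℕ.n<1+n k

    cmp : ∀ {x y} → x ∈ L → y ∈ L → c x ≡ c y → x ≲ y ⊎ y ≲ x
    cmp {x} {y} x∈L y∈L eq with em {x ∈ M} | em {y ∈ M}
    ... | yes x∈M | yes y∈M = comparable 𝒞 x∈M y∈M eq
    ... | yes x∈M | no  _   = contradiction eq (ℕ.<⇒≢ (colour< 𝒞 x∈M))
    ... | no  _   | yes y∈M = contradiction (sym eq) (ℕ.<⇒≢ (colour< 𝒞 y∈M))
    ... | no  x∉M | no  y∉M = chain x∈L y∈L x∉M y∉M

  module _ {L k m} (𝒜 : Antichain L m) (𝒞 : ChainCover L k) where

    memberColour : Fin m → Fin k
    memberColour i = fromℕ< (colour< 𝒞 (member∈ 𝒜 i))

    memberColour-injective : Injective _≡_ _≡_ memberColour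
    memberColour-injective {i} {j} eq with i ≟ᶠ j
    ... | yes i≡j = i≡j
    ... | no  i≢j = contradiction
      (comparable 𝒞 (member∈ 𝒜 i) (member∈ 𝒜 j) (fromℕ<-injective _ _ _ _ eq))
      [ incomparable 𝒜 i≢j , incomparable 𝒜 (≢-sym i≢j) ]′

    antichain≤cover : m ≤ k
    antichain≤cover = injective⇒≤ memberColour-injective

  -- Equal sizes make `memberColour` an injective self-map of `Fin k`, hence onto.
  antichain-meets-chains : ∀ {L k} (𝒜 : Antichain L k) (𝒞 : ChainCover L k) (i : Fin k) →
                           ∃ λ j → colour 𝒞 (member 𝒜 j) ≡ toℕ i
  antichain-meets-chains 𝒜 𝒞 i with injective⇒hits (memberColour-injective 𝒜 𝒞) i
  ... | j , refl = j , sym (toℕ-fromℕ< _)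

  -- The earliest element satisfying `P` serves: those before it fail `P`, and it lies below none
  -- after it. The left alternative is for the element itself.
  first : (P : Pred A ℓ) → ∀ {L} → Descending L → ∀ {y} → y ∈ L → P y →
          ∃ λ x → x ∈ L × P x × (∀ {z} → z ∈ L → P z → z ≲ x ⊎ ¬ x ≲ z)
  first P {x ∷ L} (x≴L ∷ desc) y∈ Py with em {P x}
  ... | yes Px = x , here refl , Px , λ where
          (here refl) _ → inj₁ ≲-refl
          (there z∈L) _ → inj₂ (All.lookup x≴L z∈L)
  first P {x ∷ L} (x≴L ∷ desc) (here refl) Py | no ¬Px = contradiction Py ¬Px
  first P {x ∷ L} (x≴L ∷ desc) (there y∈L) Py | no ¬Px with first P desc y∈L Py
  ... | t , t∈L , Pt , above = t , there t∈L , Pt , λ where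
          (here refl) Px → contradiction Px ¬Px
          (there z∈L) → above z∈L

  -- Beside a cover of size `k` no antichain has more than `k` members, so one of size `k` is
  -- maximum.
  InMaximum : List A → ℕ → Pred A ℓ
  InMaximum L k x = ∃ λ (𝒜 : Antichain L k) → ∃ λ j → member 𝒜 j ≡ x

  record Top {L k} (𝒞 : ChainCover L k) (i : Fin k) : Set ℓ where
    field
      top         : A
      top∈        : top ∈ L
      top-colour  : colour 𝒞 top ≡ toℕ i
      top-maximum : InMaximum L k top
      top-above   : ∀ {y} → y ∈ L → colour 𝒞 y ≡ toℕ i → InMaximum L k y → y ≲ top

  open Top

  -- Chain `i` meets `𝒜`, so `first` has something to find; within a chain, not being below an
  -- element means being above it.
  chain-top : ∀ {L k} → Descending L → Antichain L k → (𝒞 : ChainCover L k) → ∀ i → Top 𝒞 i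
  chain-top {L} {k} desc 𝒜 𝒞 i
    with j , c≡i ← antichain-meets-chains 𝒜 𝒞 i
    with x , x∈L , (cx≡i , x-max) , above ←
           first (λ y → colour 𝒞 y ≡ toℕ i × InMaximum L k y) desc
                 (member∈ 𝒜 j) (c≡i , 𝒜 , j , refl)
    = record
    { top = x ; top∈ = x∈L ; top-colour = cx≡i ; top-maximum = x-max
    ; top-above = λ y∈L cy≡i y-max →
        [ id
        , (λ x≴y → [ id , (λ x≲y → contradiction x≲y x≴y) ]′
                     (comparable 𝒞 y∈L x∈L (trans cy≡i (sym cx≡i))))
        ]′ (above y∈L (cy≡i , y-max))
    }

  -- A maximum antichain through the j-th top meets chain i below the i-th top.
  tops-incomparable : ∀ {L k} {𝒞 : ChainCover L k} {i j} (s : Top 𝒞 i) (t : Top 𝒞 j) →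
                      i ≢ j → ¬ top s ≲ top t
  tops-incomparable {𝒞 = 𝒞} {i} {j} s t i≢j s≲t
    with 𝒜 , l , eq ← top-maximum t
    with l′ , c≡i ← antichain-meets-chains 𝒜 𝒞 i
    with l′ ≟ᶠ l
  ... | yes refl = i≢j (toℕ-injective
          (trans (sym c≡i) (trans (cong (colour 𝒞) eq) (top-colour t))))
  ... | no l′≢l = incomparable 𝒜 l′≢l (subst (member 𝒜 l′ ≲_) (sym eq)
          (≲-trans (top-above s (member∈ 𝒜 l′) c≡i (𝒜 , l′ , refl)) s≲t))

  private
    -- The induction is on a length bound because the second case recurses on a filtered list `M`,
    -- not on a tail.
    galvin : ∀ n L → length L ≤ n → Descending L → ∃ λ k → Antichain L k × ChainCover L k
    galvin n [] _ _ = 0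
      , record { member = λ () ; member∈ = λ () ; incomparable = λ {} }
      , record { colour = λ _ → 0 ; colour< = λ () ; comparable = λ () }
    galvin (suc n) (a ∷ L) (s≤s |L|≤n) (a≴L ∷ desc)
      with k , 𝒜 , 𝒞 ← galvin n L |L|≤n desc
      with em {∃ λ i → top (chain-top desc 𝒜 𝒞 i) ≲ a}
    -- No top lies below `a`, and `a` lies below no top by descent. So `a` and the tops form the
    -- antichain, and `a` alone is the new chain.
    ... | no tops≴a = suc k
          , record { member = tops⁺ ; member∈ = tops⁺∈ ; incomparable = tops⁺-incomparable }
          , cover-adjoin 𝒞 λ where
              (here refl) (here refl) _   _   → inj₁ ≲-refl
              (there x∈L) _           x∉L _   → contradiction x∈L x∉L
              _           (there y∈L) _   y∉L → contradiction y∈L y∉L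
      where
      tops : ∀ i → Top 𝒞 i
      tops = chain-top desc 𝒜 𝒞

      tops⁺ : Fin (suc k) → A
      tops⁺ = a Vector.∷ (top ∘ tops)

      tops⁺∈ : ∀ i → tops⁺ i ∈ a ∷ L
      tops⁺∈ zero    = here refl
      tops⁺∈ (suc i) = there (top∈ (tops i))

      tops⁺-incomparable : ∀ {i j} → i ≢ j → ¬ tops⁺ i ≲ tops⁺ j
      tops⁺-incomparable {zero}  {zero}  0≢0 = contradiction refl 0≢0
      tops⁺-incomparable {zero}  {suc j} _   = All.lookup a≴L (top∈ (tops j))
      tops⁺-incomparable {suc i} {zero}  _   = tops≴a ∘ (i ,_)
      tops⁺-incomparable {suc i} {suc j} i≢j =
        tops-incomparable (tops i) (tops j) (i≢j ∘ cong suc)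
    ... | yes (i , t≲a) = reduce (galvin n M |M|≤n (AllPairs.filter⁺ K? desc))
      where
      t : Top 𝒞 i
      t = chain-top desc 𝒜 𝒞 i

      -- Together with a, the elements of K form a chain, and every antichain
      -- of size k meets K.
      K : Pred A ℓ
      K z = colour 𝒞 z ≡ toℕ i × z ≲ top t

      K? : ∀ z → Dec (¬ K z)
      K? z = ¬? em

      M : List A
      M = filter K? L

      M⊆L : M ⊆ L
      M⊆L = proj₁ ∘ ∈-filter⁻ K? {xs = L}

      |M|≤n : length M ≤ n
      |M|≤n = ℕ.≤-trans (length-filter K? L) |L|≤n

      removed : ∀ {z} → z ∈ L → z ∉ M → K z
      removed z∈L z∉M = decidable-stable em (z∉M ∘ ∈-filter⁺ K? z∈L)

      removed≲a : ∀ {z} → z ∈ L → z ∉ M → z ≲ a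
      removed≲a z∈L z∉M = ≲-trans (proj₂ (removed z∈L z∉M)) t≲a

      -- `ℬ` would be a maximum antichain of `L`, so its member on chain `i` would lie below `top t`
      -- and have been filtered out.
      no-maximum : ¬ Antichain M k
      no-maximum ℬ
        with j , c≡i ← antichain-meets-chains (antichain-mono M⊆L ℬ) 𝒞 i
        = proj₂ (∈-filter⁻ K? {xs = L} (member∈ ℬ j))
            (c≡i , top-above t (M⊆L (member∈ ℬ j)) c≡i (antichain-mono M⊆L ℬ , j , refl))

      reduce : (∃ λ l → Antichain M l × ChainCover M l) →
               ∃ λ k → Antichain (a ∷ L) k × ChainCover (a ∷ L) k
      reduce (l , ℬ , 𝒟) = k , antichain-mono there 𝒜 ,
        -- `𝒞` gives `l ≤ k` and `no-maximum` excludes equality. This leaves room for one more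
        -- chain, made of `a` and the removed elements.
        cover-mono
          (ℕ.≤∧≢⇒< (antichain≤cover (antichain-mono M⊆L ℬ) 𝒞)
                   (λ { refl → no-maximum ℬ }))
          (cover-adjoin 𝒟 λ where
            (here refl) (here refl) _   _   → inj₁ ≲-refl
            (here refl) (there y∈L) _   y∉M → inj₂ (removed≲a y∈L y∉M)
            (there x∈L) (here refl) x∉M _   → inj₁ (removed≲a x∈L x∉M)
            (there x∈L) (there y∈L) x∉M y∉M → comparable 𝒞 x∈L y∈L
              (trans (proj₁ (removed x∈L x∉M)) (sym (proj₁ (removed y∈L y∉M)))))

  dilworth : ∀ L → Descending L → ∃ λ k → Antichain L k × ChainCover L k
  dilworth L = galvin (length L) L ℕ.≤-refl

-- Incomparability graphs of families of finite sets

subsets : ∀ n → List (Subset n)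
subsets zero    = [ Vec.[] ]
subsets (suc n) = map (inside Vec.∷_) (subsets n) ++ map (outside Vec.∷_) (subsets n)

∈-subsets : ∀ {n} (p : Subset n) → p ∈ subsets n
∈-subsets Vec.[]          = here refl
∈-subsets (true  Vec.∷ p) = ∈-++⁺ˡ (∈-map⁺ _ (∈-subsets p))
∈-subsets (false Vec.∷ p) = ∈-++⁺ʳ _ (∈-map⁺ _ (∈-subsets p))

-- Sets containing the first index are listed first, and none of them is included in a set without
-- it.
subsets-descending : ∀ n → AllPairs _⊈ˢ_ (subsets n)
subsets-descending zero    = All.[] ∷ []
subsets-descending (suc n) = AllPairs.++⁺ (extend inside) (extend outside)
  (All.map⁺ (All.universal (λ p → All.map⁺ (All.universal (λ q → in⊈out p q) _)) _))
  where
  extend : ∀ s → AllPairs _⊈ˢ_ (map (s Vec.∷_) (subsets n))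
  extend s = AllPairs.map⁺ (AllPairs.map tail-⊈ (subsets-descending n))
    where
    tail-⊈ : ∀ {p q : Subset n} → p ⊈ˢ q → (s Vec.∷ p) ⊈ˢ (s Vec.∷ q)
    tail-⊈ p⊈q sp⊆sq = p⊈q (drop-∷-⊆ sp⊆sq)

  in⊈out : ∀ (p q : Subset n) → (inside Vec.∷ p) ⊈ˢ (outside Vec.∷ q)
  in⊈out p q p⊆q with () ← p⊆q Vec.here

clique≤colouring : ∀ {v e a} (G : Graph v e a) {m n} → Clique G m → Colouring G n → m ≤ n
clique≤colouring G (f , adj) (c , proper) = injective⇒≤ inj
  where
  inj : Injective _≡_ _≡_ (λ i → c ⟨$⟩ f i)
  inj {i} {j} eq with i ≟ᶠ j
  ... | yes i≡j = i≡j
  ... | no  i≢j = contradiction eq (proper (adj i≢j))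

module _ {v e a : Level} {n : ℕ} (em₀ : ExcludedMiddle Level.zero) (G : Graph v e a) where
  open Graph G

  module _ (s : Vertex → Subset n) (s-cong : ∀ {x y} → x ≈ y → s x ≡ s y)
           (adj⇔ : ∀ {x y} → Adj x y ⇔ (s x ⊈ˢ s y × s y ⊈ˢ s x)) where

    open Dilworth em₀ (_⊆ˢ_ {n}) ⊆ˢ-refl ⊆ˢ-trans

    -- An antichain among the sets that occur lifts to a clique through chosen vertices, and a chain
    -- cover pulls back to a colouring. Their sizes agree, so `clique≤colouring` makes both optimal.
    incomparability-perfect : ∀ {p} → ExcludedMiddle (v ⊔ p) → Perfect p G
    incomparability-perfect {p} em P _ =
      let k , 𝒜 , 𝒞 = dilworth L (AllPairs.filter⁺ realised? (subsets-descending n)) in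
      finite k
      , (clique 𝒜 , λ m 𝒦 → clique≤colouring H 𝒦 (colouring 𝒞))
      , (colouring 𝒞 , λ m → clique≤colouring H (clique 𝒜))
      where
      H : Graph (v ⊔ p) e a
      H = induced G P

      Realised : Pred (Subset n) (v ⊔ p)
      Realised q = ∃ λ (x : Graph.Vertex H) → s (proj₁ x) ≡ q

      realised? : ∀ q → Dec (Realised q)
      realised? q = em

      L : List (Subset n)
      L = filter realised? (subsets n)

      support∈L : ∀ (x : Graph.Vertex H) → s (proj₁ x) ∈ L
      support∈L x = ∈-filter⁺ realised? (∈-subsets _) (x , refl)

      clique : ∀ {k} → Antichain L k → Clique H k
      clique {k} 𝒜 = proj₁ ∘ vertex , λ {i} {j} i≢j →
        Equivalence.from adj⇔ (vertices-⊈ i≢j , vertices-⊈ (≢-sym i≢j))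
        where
        open Antichain 𝒜

        vertex : ∀ i → Realised (member i)
        vertex i = proj₂ (∈-filter⁻ realised? {xs = subsets n} (member∈ i))

        vertices-⊈ : ∀ {i j} → i ≢ j → s (proj₁ (proj₁ (vertex i))) ⊈ˢ s (proj₁ (proj₁ (vertex j)))
        vertices-⊈ {i} {j} i≢j = subst₂ _⊈ˢ_ (sym (proj₂ (vertex i))) (sym (proj₂ (vertex j)))
                                   (incomparable i≢j)

      colouring : ∀ {k} → ChainCover L k → Colouring H k
      colouring 𝒞 = record
        { to   = λ x → fromℕ< (colour< (support∈L x))
        ; cong = λ x≈y → fromℕ<-cong _ _ (cong colour (s-cong x≈y)) _ _
        } , λ {x} {y} xy eq →
          [ proj₁ (Equivalence.to adj⇔ xy) , proj₂ (Equivalence.to adj⇔ xy) ]′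
            (comparable (support∈L x) (support∈L y) (fromℕ<-injective _ _ _ _ eq))
        where open ChainCover 𝒞

-- Supports in a von Neumann regular ring

module _ {c ℓ : Level} (R : CommutativeRing c ℓ) where
  open CommutativeRing R
    hiding (zero) renaming (refl to ≈-refl; sym to ≈-sym; trans to ≈-trans)
  open Divisibility semiring using (_∣_; _,_; _∤_; ∣-trans; ∣-reflexive)
  open CommutativeSemigroupProperties *-commutativeSemigroup
    using (interchange; x∙yz≈y∙xz; xy∙z≈xz∙y)
  open GroupProperties +-group using (x∙y⁻¹≈ε⇒x≈y; x≈y⇒x∙y⁻¹≈ε)
  open RingProperties ring using (x[y-z]≈xy-xz)
  open import Relation.Binary.Reasoning.Setoid setoid

  -- Orthogonal families

  record Orthogonal (m : ℕ) : Set (c ⊔ ℓ) where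
    field
      element    : Fin m → Carrier
      nonzero    : ∀ i → element i ≉ 0#
      orthogonal : ∀ {i j} → i ≢ j → element i * element j ≈ 0#

  open Orthogonal

  *-zeroˡ : ∀ {x y} → x ≈ 0# → x * y ≈ 0#
  *-zeroˡ x≈0 = ≈-trans (*-congʳ x≈0) (zeroˡ _)

  *-zeroʳ : ∀ {x y} → y ≈ 0# → x * y ≈ 0#
  *-zeroʳ y≈0 = ≈-trans (*-congˡ y≈0) (zeroʳ _)

  -- The factor `g` makes the old members orthogonal to `x` and keeps them orthogonal to each other.
  adjoin : ∀ {m} (E : Orthogonal m) {x g} → x ≉ 0# → x * g ≈ 0# →
           (∀ i → element E i * g ≉ 0#) → Orthogonal (suc m)
  adjoin {m} E {x} {g} x≉0 xg≈0 eg≉0 = record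
    { element    = family
    ; nonzero    = λ where
        zero    → x≉0
        (suc i) → eg≉0 i
    ; orthogonal = family-orthogonal
    }
    where
    family : Fin (suc m) → Carrier
    family = x Vector.∷ (λ i → element E i * g)

    x*eg≈0 : ∀ i → x * (element E i * g) ≈ 0#
    x*eg≈0 i = ≈-trans (x∙yz≈y∙xz _ _ _) (*-zeroʳ xg≈0)

    family-orthogonal : ∀ {i j} → i ≢ j → family i * family j ≈ 0#
    family-orthogonal {zero}  {zero}  0≢0 = contradiction refl 0≢0
    family-orthogonal {zero}  {suc j} _   = x*eg≈0 j
    family-orthogonal {suc i} {zero}  _   = ≈-trans (*-comm _ _) (x*eg≈0 i)
    family-orthogonal {suc i} {suc j} i≢j =
      ≈-trans (interchange _ _ _ _) (*-zeroˡ (orthogonal E (i≢j ∘ cong suc)))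

  -- Divisibility, annihilators and cliques under regularity

  module _ (regular : VonNeumannRegular R) where

    reduced : ∀ {x} → x * x ≈ 0# → x ≈ 0#
    reduced {x} xx≈0 = let s , x≈xxs = regular x in ≈-trans x≈xxs (*-zeroˡ xx≈0)

    -- If `q * y ≈ x` then `x * x ≈ q * (x * y) ≈ 0#`, and a regular ring is reduced.
    orthogonal∣⇒≈0 : ∀ {x y} → x * y ≈ 0# → y ∣ x → x ≈ 0#
    orthogonal∣⇒≈0 {x} {y} xy≈0 (q , qy≈x) = reduced (begin
      x * x        ≈⟨ *-congˡ qy≈x ⟨
      x * (q * y)  ≈⟨ x∙yz≈y∙xz x q y ⟩
      q * (x * y)  ≈⟨ *-zeroʳ xy≈0 ⟩
      0#           ∎)

    -- If x = x²s then g = 1 − xs generates the annihilator of x, and y g = y − (ys)x.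
    annihilator : ∀ x → ∃ λ g → x * g ≈ 0# × (∀ {y} → y * g ≈ 0# → x ∣ y)
    annihilator x with s , x≈xxs ← regular x = 1# - x * s
      , (begin
          x * (1# - x * s)       ≈⟨ x[y-z]≈xy-xz x 1# (x * s) ⟩
          x * 1# - x * (x * s)   ≈⟨ x≈y⇒x∙y⁻¹≈ε (begin
            x * 1#       ≈⟨ *-identityʳ x ⟩
            x            ≈⟨ x≈xxs ⟩
            x * x * s    ≈⟨ *-assoc x x s ⟩
            x * (x * s)  ∎) ⟩
          0#                     ∎)
      , λ {y} yg≈0 → y * s , (begin
          y * s * x    ≈⟨ *-assoc y s x ⟩
          y * (s * x)  ≈⟨ *-congˡ (*-comm s x) ⟩
          y * (x * s)  ≈⟨ x∙y⁻¹≈ε⇒x≈y _ _ (≈-trans (≈-sym (x[y-z]≈xy-xz y 1# (x * s))) yg≈0) ⟨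
          y * 1#       ≈⟨ *-identityʳ y ⟩
          y            ∎)

    -- Let `g` generate the annihilator of `x`. If `x` divides no member, then `g` annihilates none,
    -- and `adjoin` yields a family that is too large.
    divides-some : ExcludedMiddle (c ⊔ ℓ) → ∀ {m} (E : Orthogonal m) → ¬ Orthogonal (suc m) →
                   ∀ {x} → x ≉ 0# → ∃ λ i → x ∣ element E i
    divides-some em E maximal {x} x≉0 =
      let g , xg≈0 , yg≈0⇒x∣y = annihilator x in
      decidable-stable em λ x∤E →
        maximal (adjoin E x≉0 xg≈0 λ i eg≈0 → x∤E (i , yg≈0⇒x∣y eg≈0))

    -- With two members or more none is a unit: a unit would divide another member, against
    -- orthogonality.
    orthogonal⇒clique : ∀ {m} → Orthogonal (suc (suc m)) →
                        Clique (cozeroDivisorGraph R) (suc (suc m))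
    orthogonal⇒clique {m} E = (λ i → element E i , nonzero E i , nonunit i) , λ i≢j →
      (λ ei≈ej → e∤e i≢j (∣-reflexive ei≈ej)) , e∤e (≢-sym i≢j) , e∤e i≢j
      where
      e∤e : ∀ {i j} → i ≢ j → element E i ∤ element E j
      e∤e {i} {j} i≢j ei∣ej = nonzero E j (orthogonal∣⇒≈0 (orthogonal E (≢-sym i≢j)) ei∣ej)

      other : ∀ (i : Fin (suc (suc m))) → ∃ λ j → i ≢ j
      other zero    = suc zero , λ ()
      other (suc i) = zero , λ ()

      nonunit : ∀ i → ¬ (∃ λ u → u * element E i ≈ 1# × element E i * u ≈ 1#)
      nonunit i (u , ue≈1 , _) with j , i≢j ← other i = e∤e i≢j (element E j * u , (begin
        element E j * u * element E i    ≈⟨ *-assoc _ _ _ ⟩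
        element E j * (u * element E i)  ≈⟨ *-congˡ ue≈1 ⟩
        element E j * 1#                 ≈⟨ *-identityʳ _ ⟩
        element E j                      ∎))

    -- A one-element family need not be a clique: its element may be a unit.
    orthogonal-bounded : ∀ {k} → IsCliqueNumber (cozeroDivisorGraph R) (finite k) →
                         ∀ m → Orthogonal m → m ≤ suc k
    orthogonal-bounded _         zero          _ = z≤n
    orthogonal-bounded _         (suc zero)    _ = s≤s z≤n
    orthogonal-bounded (_ , ω≤k) (suc (suc m)) E = ℕ.m≤n⇒m≤1+n (ω≤k _ (orthogonal⇒clique E))

    -- Maximality concerns size alone, since `adjoin` multiplies the old members by `g` instead of
    -- keeping them.
    maximal-orthogonal : ExcludedMiddle (c ⊔ ℓ) → FiniteCliqueNumber (cozeroDivisorGraph R) →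
                         ∃ λ m → Orthogonal m × ¬ Orthogonal (suc m)
    maximal-orthogonal em (k , ω≡k) = bounded⇒last em Orthogonal
      record { element = λ () ; nonzero = λ () ; orthogonal = λ {} }
      (suc k) (orthogonal-bounded ω≡k)

    -- Supports relative to a maximal orthogonal family

    module _ (em : ExcludedMiddle (c ⊔ ℓ)) {m : ℕ}
             (E : Orthogonal m) (maximal : ¬ Orthogonal (suc m)) where

      -- The product `x * element E i` divides some `element E j`. If `j ≢ i`, then `element E i`
      -- would divide a non-zero element orthogonal to it.
      divides-element : ∀ {x i} → x * element E i ≉ 0# → x ∣ element E i
      divides-element {x} {i} xe≉0 with j , xe∣ej ← divides-some em E maximal xe≉0 with j ≟ᶠ i
      ... | yes refl = ∣-trans (element E i , *-comm _ _) xe∣ej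
      ... | no  j≢i  = contradiction
        (orthogonal∣⇒≈0 (orthogonal E j≢i) (∣-trans (x , ≈-refl) xe∣ej))
        (nonzero E j)

      -- A non-zero `x` would divide some `element E i`, which it annihilates.
      faithful : ∀ {x} → (∀ i → x * element E i ≈ 0#) → x ≈ 0#
      faithful {x} xe≈0 = decidable-stable (lower-em c em) λ x≉0 →
        let i , x∣ei = divides-some em E maximal x≉0 in
        nonzero E i (orthogonal∣⇒≈0 (≈-trans (*-comm _ _) (xe≈0 i)) x∣ei)

      zero? : ∀ x → Dec (x ≈ 0#)
      zero? x = lower-em c em

      support : Carrier → Subset m
      support x = Vec.tabulate λ i → does (¬? (zero? (x * element E i)))

      support-cong : ∀ {x y} → x ≈ y → support x ≡ support y
      support-cong x≈y = tabulate-cong λ i → does-⇔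
        (mk⇔ (λ xe≉0 → xe≉0 ∘ ≈-trans (*-congʳ x≈y))
             (λ ye≉0 → ye≉0 ∘ ≈-trans (*-congʳ (≈-sym x≈y))))
        (¬? (zero? _)) (¬? (zero? _))

      ∈-support⁺ : ∀ {x i} → x * element E i ≉ 0# → i ∈ˢ support x
      ∈-support⁺ {x} {i} xe≉0 = lookup⇒[]= i (support x)
        (trans (lookup∘tabulate _ i) (dec-true (¬? (zero? _)) xe≉0))

      ∈-support⁻ : ∀ {x i} → i ∈ˢ support x → x * element E i ≉ 0#
      ∈-support⁻ {x} {i} i∈ xe≈0
        with () ← trans (sym ([]=⇒lookup i∈))
                    (trans (lookup∘tabulate _ i) (dec-false (¬? (zero? _)) (contradiction xe≈0)))

      ∣⇒support⊆ : ∀ {x y} → x ∣ y → support y ⊆ˢ support x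
      ∣⇒support⊆ {x} {y} (q , qx≈y) {i} i∈y = ∈-support⁺ λ xe≈0 → ∈-support⁻ i∈y (begin
        y * element E i        ≈⟨ *-congʳ qx≈y ⟨
        q * x * element E i    ≈⟨ *-assoc _ _ _ ⟩
        q * (x * element E i)  ≈⟨ *-zeroʳ xe≈0 ⟩
        0#                     ∎)

      -- Let `g` generate the annihilator of `x`. By `faithful` it is enough that `y * g`
      -- annihilates each member: either `y` does, or `x` divides the member and then `g` does.
      support⊆⇒∣ : ∀ {x y} → support y ⊆ˢ support x → x ∣ y
      support⊆⇒∣ {x} {y} y⊆x = x∣ (faithful yge≈0)
        where
        open Σ (annihilator x) renaming (proj₁ to g; proj₂ to g-generates)
        open Σ g-generates renaming (proj₁ to xg≈0; proj₂ to x∣)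

        yge≈0 : ∀ i → y * g * element E i ≈ 0#
        yge≈0 i with zero? (y * element E i)
        ... | yes ye≈0 = ≈-trans (xy∙z≈xz∙y _ _ _) (*-zeroˡ ye≈0)
        ... | no  ye≉0
          with q , qx≈e ← divides-element (∈-support⁻ (y⊆x (∈-support⁺ ye≉0))) = begin
          y * g * element E i   ≈⟨ *-congˡ qx≈e ⟨
          y * g * (q * x)       ≈⟨ interchange _ _ _ _ ⟩
          y * q * (g * x)       ≈⟨ *-zeroʳ (≈-trans (*-comm _ _) xg≈0) ⟩
          0#                     ∎

      adjacent⇔incomparable : ∀ {x y} →
        CozeroAdj R x y ⇔ (support x ⊈ˢ support y × support y ⊈ˢ support x)
      adjacent⇔incomparable = mk⇔
        (λ (_ , y∤x , x∤y) → (λ x⊆y → y∤x (support⊆⇒∣ x⊆y)) , (λ y⊆x → x∤y (support⊆⇒∣ y⊆x)))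
        (λ (x⊈y , y⊈x) → (λ x≈y → x⊈y (⊆ˢ-reflexive (support-cong x≈y)))
                       , (λ y∣x → x⊈y (∣⇒support⊆ y∣x))
                       , (λ x∣y → y⊈x (∣⇒support⊆ x∣y)))

theorem3p4 : ∀ {c ℓ : Level} (p : Level) → ExcludedMiddle (c ⊔ ℓ ⊔ p) →
    (R : CommutativeRing c ℓ) → Nontrivial R →
    VonNeumannRegular R →
    FiniteCliqueNumber (cozeroDivisorGraph R) →
    Perfect p (cozeroDivisorGraph R)
theorem3p4 {c} {ℓ} p em R _ regular ω<∞ =
  let em′ : ExcludedMiddle (c ⊔ ℓ)
      em′ = lower-em p em
      m , E , maximal = maximal-orthogonal R regular em′ ω<∞
  in
  -- Level zero serves to compare subsets; the full `em` decides whether a subset is the support of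
  -- a vertex in the chosen vertex set.
  incomparability-perfect (lower-em (c ⊔ ℓ ⊔ p) em) (cozeroDivisorGraph R)
    (support R regular em′ E maximal ∘ proj₁)
    (support-cong R regular em′ E maximal)
    (adjacent⇔incomparable R regular em′ E maximal)
    em
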